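{- For any real $\alpha$ with $0<\alpha<4$, no strictly monotone deterministic online algorithm for maximizing a non-negative monotone submodular function under a partition matroid constraint with free disposal, on instances of the form described in the context (all parts of capacity $1$), can have competitive ratio strictly larger than $\frac1\alpha$.
   Context: Instances: let $\mathcal{U}$ be a universe of items with weights $\nu:\mathcal{U}\to\mathbb{R}_+$, and $\nu(X):=\sum_{x\in X}\nu(x)$ for $X\subseteq\mathcal{U}$. For $i\ge0$ let $\Omega_i:=\{(u,i):u\in\mathcal{U}\}$ and let $\Omega:=\bigcup_{i\ge0}\Omega_i$. A (finite) set $S\subset\Omega$ is independent iff $|S\cap\Omega_i|\le1$ for all $i$ (a partition matroid with unit capacities). The objective is $f(S):=\nu(\{x:(x,i)\in S\text{ for some }i\})$, which is monotone submodular. Online problem with free disposal: distinct elements of $\Omega$ arrive one by one in a finite sequence whose length is unknown to the algorithm. The algorithm maintains an independent set $S$, initially empty. When $u$ arrives, it may remove elements from $S$ and may include $u$ in $S$, as long as $S$ remains independent; rejected or removed elements cannot be retrieved. The algorithm has a value oracle for $f$ and an independence oracle, only on sets of elements that have arrived so far, so the decisions of a deterministic algorithm are determined by this information. $\mathsf{OPT}$ is an independent set of elements of the sequence maximizing $f$. A deterministic algorithm has competitive ratio $r$ if for every instance and at the end of every finite sequence, $f(S)\ge r\cdot f(\mathsf{OPT})$. Strict monotonicity: an algorithm is strictly monotone if, in each round, it includes the new arriving element into $S$ (possibly removing some elements from $S$) only if the objective value $f(S)$ strictly increases compared to its value at the beginning of the round. -}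

module Defs where

open import Data.Bool using (Bool; true; false; T)
open import Data.Fin using (zero; suc)
open import Data.Fin.Properties using (all?)
open import Data.Fin.Subset using (Subset; inside; outside; _∩_; ∣_∣)
open import Data.List using (List; []; _∷_; map; foldr; deduplicate)
open import Data.Nat as ℕ using (ℕ; zero; suc; z≤n)
import Data.Nat.Properties as ℕ
open import Data.Product using (∃-syntax; _×_; _,_; proj₁; proj₂)
open import Data.Rational as ℚ using (ℚ; 0ℚ; 1ℚ; 1/_)
import Data.Rational.Properties as ℚ
open import Data.Rational.Solver using (module +-*-Solver)
open import Data.Sum using (_⊎_; inj₁; inj₂)
open import Data.Vec as Vec using (Vec; []; _∷_; lookup)
open import Data.Vec.Relation.Unary.Unique.Propositional using (Unique)
open import Relation.Binary using (DecidableEquality)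
open import Relation.Binary.PropositionalEquality
  using (_≡_; refl; sym; trans; cong; cong₂; subst; subst₂)
open import Relation.Nullary using (¬_; Dec; does)
open import Relation.Nullary.Decidable using (map′)

-- Real numbers, as Cauchy sequences of rationals with a modulus of
-- convergence.  Equality of reals is _≈_, not _≡_.

record ℝ : Set where
  constructor mkℝ
  field
    seq    : ℕ → ℚ
    cauchy : ∀ ε → 0ℚ ℚ.< ε →
             ∃[ N ] (∀ m n → N ℕ.≤ m → N ℕ.≤ n → ℚ.∣ seq m ℚ.- seq n ∣ ℚ.< ε)

open ℝ public

infix  4 _<_ _≤_ _≈_
infixl 6 _+_
infixl 7 _*_

_<_ : ℝ → ℝ → Set
x < y = ∃[ ε ] (0ℚ ℚ.< ε × ∃[ N ] (∀ n → N ℕ.≤ n → seq x n ℚ.+ ε ℚ.≤ seq y n))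

_≤_ : ℝ → ℝ → Set
x ≤ y = ¬ (y < x)

_≈_ : ℝ → ℝ → Set
x ≈ y = x ≤ y × y ≤ x

fromℚ : ℚ → ℝ
fromℚ q = mkℝ (λ _ → q) λ ε 0<ε →
  0 , λ _ _ _ _ → subst (λ d → ℚ.∣ d ∣ ℚ.< ε) (sym (ℚ.+-inverseʳ q)) 0<ε

0ℝ 1ℝ : ℝ
0ℝ = fromℚ 0ℚ
1ℝ = fromℚ 1ℚ

module Construction where
  open +-*-Solver using (solve; _:=_; _:+_; _:*_; _:-_)

  +-interchange : ∀ a b c d →
    (a ℚ.+ b) ℚ.- (c ℚ.+ d) ≡ (a ℚ.- c) ℚ.+ (b ℚ.- d)
  +-interchange =
    solve 4 (λ a b c d → (a :+ b) :- (c :+ d) := (a :- c) :+ (b :- d)) refl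

  add-sub : ∀ a b → a ≡ (a ℚ.- b) ℚ.+ b
  add-sub = solve 2 (λ a b → a := (a :- b) :+ b) refl

  *-diff : ∀ a b c d →
    a ℚ.* b ℚ.- c ℚ.* d ≡ a ℚ.* (b ℚ.- d) ℚ.+ (a ℚ.- c) ℚ.* d
  *-diff = solve 4 (λ a b c d → a :* b :- c :* d := a :* (b :- d) :+ (a :- c) :* d) refl

  *-factor : ∀ a b c → a ℚ.* c ℚ.+ c ℚ.* b ≡ (a ℚ.+ b) ℚ.* c
  *-factor = solve 3 (λ a b c → a :* c :+ c :* b := (a :+ b) :* c) refl

  *-swap : ∀ a b c → a ℚ.* (b ℚ.* c) ≡ b ℚ.* (a ℚ.* c)
  *-swap = solve 3 (λ a b c → a :* (b :* c) := b :* (a :* c)) refl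

  *-cross : ∀ p q a b →
    (q ℚ.- p) ℚ.* (a ℚ.* b) ≡ a ℚ.* (q ℚ.* b) ℚ.- b ℚ.* (p ℚ.* a)
  *-cross = solve 4 (λ p q a b → (q :- p) :* (a :* b) := a :* (q :* b) :- b :* (p :* a)) refl

  *-regroup : ∀ a b c →
    a ℚ.* (b ℚ.* b) ℚ.* (c ℚ.* c) ≡ a ℚ.* ((b ℚ.* c) ℚ.* (b ℚ.* c))
  *-regroup =
    solve 3 (λ a b c → a :* (b :* b) :* (c :* c) := a :* ((b :* c) :* (b :* c))) refl

  recip⁺ : (q : ℚ) → 0ℚ ℚ.< q → ℚ
  recip⁺ q 0<q = (1/ q) {{ℚ.pos⇒nonZero q {{ℚ.positive 0<q}}}}

  recip⁺-pos : ∀ q (0<q : 0ℚ ℚ.< q) → 0ℚ ℚ.< recip⁺ q 0<q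
  recip⁺-pos q 0<q =
    ℚ.positive⁻¹ _ {{ℚ.1/pos⇒pos q {{ℚ.positive 0<q}}}}

  recip⁺-inverseʳ : ∀ q (0<q : 0ℚ ℚ.< q) → q ℚ.* recip⁺ q 0<q ≡ 1ℚ
  recip⁺-inverseʳ q 0<q = ℚ.*-inverseʳ q {{ℚ.pos⇒nonZero q {{ℚ.positive 0<q}}}}

  *-pos : ∀ {p q} → 0ℚ ℚ.< p → 0ℚ ℚ.< q → 0ℚ ℚ.< p ℚ.* q
  *-pos {p} {q} 0<p 0<q = ℚ.positive⁻¹ _
    {{ℚ.pos*pos⇒pos p {{ℚ.positive 0<p}} q {{ℚ.positive 0<q}}}}

  *-mono : ∀ {p q r s} → 0ℚ ℚ.≤ p → 0ℚ ℚ.≤ s →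
           p ℚ.≤ q → r ℚ.≤ s → p ℚ.* r ℚ.≤ q ℚ.* s
  *-mono {p} {q} {r} {s} 0≤p 0≤s p≤q r≤s = ℚ.≤-trans
    (ℚ.*-monoˡ-≤-nonNeg p {{ℚ.nonNegative 0≤p}} r≤s)
    (ℚ.*-monoʳ-≤-nonNeg s {{ℚ.nonNegative 0≤s}} p≤q)

  ½-pos : 0ℚ ℚ.< ℚ.½
  ½-pos = ℚ.positive⁻¹ ℚ.½

  halves : ∀ ε → ε ℚ.* ℚ.½ ℚ.+ ε ℚ.* ℚ.½ ≡ ε
  halves ε = trans (sym (ℚ.*-distribˡ-+ ε ℚ.½ ℚ.½)) (ℚ.*-identityʳ ε)

  +-cauchy : ∀ (x y : ℝ) ε → 0ℚ ℚ.< ε →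
    ∃[ N ] (∀ m n → N ℕ.≤ m → N ℕ.≤ n →
            ℚ.∣ (seq x m ℚ.+ seq y m) ℚ.- (seq x n ℚ.+ seq y n) ∣ ℚ.< ε)
  +-cauchy x y ε 0<ε with cauchy x (ε ℚ.* ℚ.½) (*-pos 0<ε ½-pos)
                        | cauchy y (ε ℚ.* ℚ.½) (*-pos 0<ε ½-pos)
  ... | M , cx | N , cy = M ℕ.⊔ N , λ m n p q → begin-strict
      ℚ.∣ (seq x m ℚ.+ seq y m) ℚ.- (seq x n ℚ.+ seq y n) ∣
        ≡⟨ cong ℚ.∣_∣ (+-interchange (seq x m) (seq y m) (seq x n) (seq y n)) ⟩
      ℚ.∣ (seq x m ℚ.- seq x n) ℚ.+ (seq y m ℚ.- seq y n) ∣
        ≤⟨ ℚ.∣p+q∣≤∣p∣+∣q∣ (seq x m ℚ.- seq x n) (seq y m ℚ.- seq y n) ⟩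
      ℚ.∣ seq x m ℚ.- seq x n ∣ ℚ.+ ℚ.∣ seq y m ℚ.- seq y n ∣
        <⟨ ℚ.+-mono-< (cx m n (ℕ.m⊔n≤o⇒m≤o M N p) (ℕ.m⊔n≤o⇒m≤o M N q))
                      (cy m n (ℕ.m⊔n≤o⇒n≤o M N p) (ℕ.m⊔n≤o⇒n≤o M N q)) ⟩
      ε ℚ.* ℚ.½ ℚ.+ ε ℚ.* ℚ.½
        ≡⟨ halves ε ⟩
      ε ∎
    where open ℚ.≤-Reasoning

  eventuallyBounded : ∀ (x : ℝ) →
    ∃[ B ] (0ℚ ℚ.< B × ∃[ N ] (∀ n → N ℕ.≤ n → ℚ.∣ seq x n ∣ ℚ.≤ B))
  eventuallyBounded x with cauchy x 1ℚ (ℚ.positive⁻¹ 1ℚ)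
  ... | N , cx =
      1ℚ ℚ.+ ℚ.∣ seq x N ∣
    , ℚ.+-mono-<-≤ (ℚ.positive⁻¹ 1ℚ) (ℚ.0≤∣p∣ (seq x N))
    , N , λ n N≤n → begin
        ℚ.∣ seq x n ∣
          ≡⟨ cong ℚ.∣_∣ (add-sub (seq x n) (seq x N)) ⟩
        ℚ.∣ (seq x n ℚ.- seq x N) ℚ.+ seq x N ∣
          ≤⟨ ℚ.∣p+q∣≤∣p∣+∣q∣ (seq x n ℚ.- seq x N) (seq x N) ⟩
        ℚ.∣ seq x n ℚ.- seq x N ∣ ℚ.+ ℚ.∣ seq x N ∣
          ≤⟨ ℚ.+-monoˡ-≤ ℚ.∣ seq x N ∣ (ℚ.<⇒≤ (cx n N N≤n ℕ.≤-refl)) ⟩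
        1ℚ ℚ.+ ℚ.∣ seq x N ∣ ∎
    where open ℚ.≤-Reasoning

  *-recip⁺ : ∀ K (0<K : 0ℚ ℚ.< K) η → K ℚ.* (η ℚ.* recip⁺ K 0<K) ≡ η
  *-recip⁺ K 0<K η = trans (*-swap K η (recip⁺ K 0<K))
    (trans (cong (η ℚ.*_) (recip⁺-inverseʳ K 0<K)) (ℚ.*-identityʳ η))

  half< : ∀ ε → 0ℚ ℚ.< ε → ε ℚ.* ℚ.½ ℚ.< ε
  half< ε 0<ε = subst₂ ℚ._<_ (ℚ.+-identityˡ (ε ℚ.* ℚ.½)) (halves ε)
    (ℚ.+-monoˡ-< (ε ℚ.* ℚ.½) (*-pos 0<ε ½-pos))

  *-close : ∀ a b c d {B C δ} → 0ℚ ℚ.≤ C → 0ℚ ℚ.≤ δ →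
    ℚ.∣ a ∣ ℚ.≤ B → ℚ.∣ d ∣ ℚ.≤ C → ℚ.∣ a ℚ.- c ∣ ℚ.≤ δ → ℚ.∣ b ℚ.- d ∣ ℚ.≤ δ →
    ℚ.∣ a ℚ.* b ℚ.- c ℚ.* d ∣ ℚ.≤ (B ℚ.+ C) ℚ.* δ
  *-close a b c d {B} {C} {δ} 0≤C 0≤δ a≤B d≤C ac bd = begin
      ℚ.∣ a ℚ.* b ℚ.- c ℚ.* d ∣
        ≡⟨ cong ℚ.∣_∣ (*-diff a b c d) ⟩
      ℚ.∣ a ℚ.* (b ℚ.- d) ℚ.+ (a ℚ.- c) ℚ.* d ∣
        ≤⟨ ℚ.∣p+q∣≤∣p∣+∣q∣ (a ℚ.* (b ℚ.- d)) ((a ℚ.- c) ℚ.* d) ⟩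
      ℚ.∣ a ℚ.* (b ℚ.- d) ∣ ℚ.+ ℚ.∣ (a ℚ.- c) ℚ.* d ∣
        ≡⟨ cong₂ ℚ._+_ (ℚ.∣p*q∣≡∣p∣*∣q∣ a (b ℚ.- d)) (ℚ.∣p*q∣≡∣p∣*∣q∣ (a ℚ.- c) d) ⟩
      ℚ.∣ a ∣ ℚ.* ℚ.∣ b ℚ.- d ∣ ℚ.+ ℚ.∣ a ℚ.- c ∣ ℚ.* ℚ.∣ d ∣
        ≤⟨ ℚ.+-mono-≤ (*-mono (ℚ.0≤∣p∣ a) 0≤δ a≤B bd)
                      (*-mono (ℚ.0≤∣p∣ (a ℚ.- c)) 0≤C ac d≤C) ⟩
      B ℚ.* δ ℚ.+ δ ℚ.* C
        ≡⟨ *-factor B C δ ⟩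
      (B ℚ.+ C) ℚ.* δ ∎
    where open ℚ.≤-Reasoning

  *-cauchy-δ : ∀ (x y : ℝ) B C M N → 0ℚ ℚ.< C →
    (∀ n → M ℕ.≤ n → ℚ.∣ seq x n ∣ ℚ.≤ B) →
    (∀ n → N ℕ.≤ n → ℚ.∣ seq y n ∣ ℚ.≤ C) →
    ∀ ε δ → 0ℚ ℚ.< δ → (B ℚ.+ C) ℚ.* δ ℚ.< ε →
    ∃[ K ] (∀ m n → K ℕ.≤ m → K ℕ.≤ n →
            ℚ.∣ (seq x m ℚ.* seq y m) ℚ.- (seq x n ℚ.* seq y n) ∣ ℚ.< ε)
  *-cauchy-δ x y B C M N 0<C bx cy ε δ 0<δ Kδ<ε =
    let (P , xδ) = cauchy x δ 0<δ
        (Q , yδ) = cauchy y δ 0<δ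
    in M ℕ.⊔ N ℕ.⊔ (P ℕ.⊔ Q) , λ m n p q →
        let p₁ = ℕ.m⊔n≤o⇒m≤o (M ℕ.⊔ N) (P ℕ.⊔ Q) p
            p₂ = ℕ.m⊔n≤o⇒n≤o (M ℕ.⊔ N) (P ℕ.⊔ Q) p
            q₁ = ℕ.m⊔n≤o⇒m≤o (M ℕ.⊔ N) (P ℕ.⊔ Q) q
            q₂ = ℕ.m⊔n≤o⇒n≤o (M ℕ.⊔ N) (P ℕ.⊔ Q) q
        in ℚ.≤-<-trans
          (*-close (seq x m) (seq y m) (seq x n) (seq y n) (ℚ.<⇒≤ 0<C) (ℚ.<⇒≤ 0<δ)
            (bx m (ℕ.m⊔n≤o⇒m≤o M N p₁))
            (cy n (ℕ.m⊔n≤o⇒n≤o M N q₁))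
            (ℚ.<⇒≤ (xδ m n (ℕ.m⊔n≤o⇒m≤o P Q p₂) (ℕ.m⊔n≤o⇒m≤o P Q q₂)))
            (ℚ.<⇒≤ (yδ m n (ℕ.m⊔n≤o⇒n≤o P Q p₂) (ℕ.m⊔n≤o⇒n≤o P Q q₂))))
          Kδ<ε

  small-multiple : ∀ K → 0ℚ ℚ.< K → ∀ ε → 0ℚ ℚ.< ε →
    ∃[ δ ] (0ℚ ℚ.< δ × K ℚ.* δ ℚ.< ε)
  small-multiple K 0<K ε 0<ε =
      ε ℚ.* ℚ.½ ℚ.* recip⁺ K 0<K
    , *-pos (*-pos 0<ε ½-pos) (recip⁺-pos K 0<K)
    , subst (ℚ._< ε) (sym (*-recip⁺ K 0<K (ε ℚ.* ℚ.½))) (half< ε 0<ε)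

  *-cauchy : ∀ (x y : ℝ) ε → 0ℚ ℚ.< ε →
    ∃[ N ] (∀ m n → N ℕ.≤ m → N ℕ.≤ n →
            ℚ.∣ (seq x m ℚ.* seq y m) ℚ.- (seq x n ℚ.* seq y n) ∣ ℚ.< ε)
  *-cauchy x y ε 0<ε =
    let (B , 0<B , M , bx) = eventuallyBounded x
        (C , 0<C , N , cy) = eventuallyBounded y
        (δ , 0<δ , Kδ<ε)   = small-multiple (B ℚ.+ C) (ℚ.+-mono-< 0<B 0<C) ε 0<ε
    in *-cauchy-δ x y B C M N 0<C bx cy ε δ 0<δ Kδ<ε

  <-⊔ : ∀ {ε} p → 0ℚ ℚ.< ε → 0ℚ ℚ.< p ℚ.⊔ ε
  <-⊔ {ε} p 0<ε = ℚ.<-≤-trans 0<ε (ℚ.p≤q⊔p p ε)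

  recip⁺-anti : ∀ {p q} (0<p : 0ℚ ℚ.< p) (0<q : 0ℚ ℚ.< q) →
                p ℚ.≤ q → recip⁺ q 0<q ℚ.≤ recip⁺ p 0<p
  recip⁺-anti {p} {q} 0<p 0<q p≤q = begin
    q⁻¹                    ≡⟨ ℚ.*-identityʳ q⁻¹ ⟨
    q⁻¹ ℚ.* 1ℚ             ≡⟨ cong (q⁻¹ ℚ.*_) (recip⁺-inverseʳ p 0<p) ⟨
    q⁻¹ ℚ.* (p ℚ.* p⁻¹)    ≤⟨ *-mono (ℚ.<⇒≤ (recip⁺-pos q 0<q))
                                (ℚ.<⇒≤ (*-pos 0<q (recip⁺-pos p 0<p)))
                                ℚ.≤-refl
                                (ℚ.*-monoʳ-≤-nonNeg p⁻¹
                                  {{ℚ.nonNegative (ℚ.<⇒≤ (recip⁺-pos p 0<p))}} p≤q) ⟩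
    q⁻¹ ℚ.* (q ℚ.* p⁻¹)    ≡⟨ *-swap q⁻¹ q p⁻¹ ⟩
    q ℚ.* (q⁻¹ ℚ.* p⁻¹)    ≡⟨ ℚ.*-assoc q q⁻¹ p⁻¹ ⟨
    q ℚ.* q⁻¹ ℚ.* p⁻¹      ≡⟨ cong (ℚ._* p⁻¹) (recip⁺-inverseʳ q 0<q) ⟩
    1ℚ ℚ.* p⁻¹             ≡⟨ ℚ.*-identityˡ p⁻¹ ⟩
    p⁻¹ ∎
    where
    open ℚ.≤-Reasoning
    p⁻¹ = recip⁺ p 0<p
    q⁻¹ = recip⁺ q 0<q

  recip⁺-diff : ∀ p q (0<p : 0ℚ ℚ.< p) (0<q : 0ℚ ℚ.< q) →
    recip⁺ p 0<p ℚ.- recip⁺ q 0<q ≡ (q ℚ.- p) ℚ.* (recip⁺ p 0<p ℚ.* recip⁺ q 0<q)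
  recip⁺-diff p q 0<p 0<q = sym (let open ℚ.≤-Reasoning in begin-equality
    (q ℚ.- p) ℚ.* (p⁻¹ ℚ.* q⁻¹)
      ≡⟨ *-cross p q p⁻¹ q⁻¹ ⟩
    p⁻¹ ℚ.* (q ℚ.* q⁻¹) ℚ.- q⁻¹ ℚ.* (p ℚ.* p⁻¹)
      ≡⟨ cong₂ (λ u v → p⁻¹ ℚ.* u ℚ.- q⁻¹ ℚ.* v)
           (recip⁺-inverseʳ q 0<q) (recip⁺-inverseʳ p 0<p) ⟩
    p⁻¹ ℚ.* 1ℚ ℚ.- q⁻¹ ℚ.* 1ℚ
      ≡⟨ cong₂ ℚ._-_ (ℚ.*-identityʳ p⁻¹) (ℚ.*-identityʳ q⁻¹) ⟩
    p⁻¹ ℚ.- q⁻¹ ∎)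
    where
    p⁻¹ = recip⁺ p 0<p
    q⁻¹ = recip⁺ q 0<q

  recip⁺-close : ∀ p q {ε η} (0<ε : 0ℚ ℚ.< ε) (0<p : 0ℚ ℚ.< p) (0<q : 0ℚ ℚ.< q) →
    ε ℚ.≤ p → ε ℚ.≤ q → ℚ.∣ q ℚ.- p ∣ ℚ.< η ℚ.* (ε ℚ.* ε) →
    ℚ.∣ recip⁺ p 0<p ℚ.- recip⁺ q 0<q ∣ ℚ.< η
  recip⁺-close p q {ε} {η} 0<ε 0<p 0<q ε≤p ε≤q d<δ = begin-strict
    ℚ.∣ p⁻¹ ℚ.- q⁻¹ ∣
      ≡⟨ cong ℚ.∣_∣ (recip⁺-diff p q 0<p 0<q) ⟩
    ℚ.∣ (q ℚ.- p) ℚ.* (p⁻¹ ℚ.* q⁻¹) ∣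
      ≡⟨ ℚ.∣p*q∣≡∣p∣*∣q∣ (q ℚ.- p) (p⁻¹ ℚ.* q⁻¹) ⟩
    ℚ.∣ q ℚ.- p ∣ ℚ.* ℚ.∣ p⁻¹ ℚ.* q⁻¹ ∣
      ≡⟨ cong (ℚ.∣ q ℚ.- p ∣ ℚ.*_) (ℚ.0≤p⇒∣p∣≡p
           (ℚ.<⇒≤ (*-pos (recip⁺-pos p 0<p) (recip⁺-pos q 0<q)))) ⟩
    ℚ.∣ q ℚ.- p ∣ ℚ.* (p⁻¹ ℚ.* q⁻¹)
      ≤⟨ ℚ.*-monoˡ-≤-nonNeg ℚ.∣ q ℚ.- p ∣ {{ℚ.nonNegative (ℚ.0≤∣p∣ (q ℚ.- p))}}
           (*-mono (ℚ.<⇒≤ (recip⁺-pos p 0<p)) (ℚ.<⇒≤ (recip⁺-pos ε 0<ε))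
                   (recip⁺-anti 0<ε 0<p ε≤p) (recip⁺-anti 0<ε 0<q ε≤q)) ⟩
    ℚ.∣ q ℚ.- p ∣ ℚ.* (ε⁻¹ ℚ.* ε⁻¹)
      <⟨ ℚ.*-monoˡ-<-pos (ε⁻¹ ℚ.* ε⁻¹)
           {{ℚ.positive (*-pos (recip⁺-pos ε 0<ε) (recip⁺-pos ε 0<ε))}} d<δ ⟩
    η ℚ.* (ε ℚ.* ε) ℚ.* (ε⁻¹ ℚ.* ε⁻¹)
      ≡⟨ *-regroup η ε ε⁻¹ ⟩
    η ℚ.* ((ε ℚ.* ε⁻¹) ℚ.* (ε ℚ.* ε⁻¹))
      ≡⟨ cong (λ u → η ℚ.* (u ℚ.* u)) (recip⁺-inverseʳ ε 0<ε) ⟩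
    η ℚ.* 1ℚ
      ≡⟨ ℚ.*-identityʳ η ⟩
    η ∎
    where
    open ℚ.≤-Reasoning
    p⁻¹ = recip⁺ p 0<p
    q⁻¹ = recip⁺ q 0<q
    ε⁻¹ = recip⁺ ε 0<ε

  ⊔-absorb : ∀ {p ε} → 0ℚ ℚ.+ ε ℚ.≤ p → p ℚ.⊔ ε ≡ p
  ⊔-absorb {p} {ε} h = ℚ.p≥q⇒p⊔q≡p (subst (ℚ._≤ p) (ℚ.+-identityˡ ε) h)

  truncRecip : ℝ → ∀ ε → 0ℚ ℚ.< ε → ℕ → ℚ
  truncRecip x ε 0<ε n = recip⁺ (seq x n ℚ.⊔ ε) (<-⊔ (seq x n) 0<ε)

  truncRecip-cauchy : ∀ x ε (0<ε : 0ℚ ℚ.< ε) N →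
    (∀ n → N ℕ.≤ n → 0ℚ ℚ.+ ε ℚ.≤ seq x n) →
    ∀ η → 0ℚ ℚ.< η → ∃[ K ] (∀ m n → K ℕ.≤ m → K ℕ.≤ n →
      ℚ.∣ truncRecip x ε 0<ε m ℚ.- truncRecip x ε 0<ε n ∣ ℚ.< η)
  truncRecip-cauchy x ε 0<ε N ε≤x η 0<η =
    let (M , xδ) = cauchy x (η ℚ.* (ε ℚ.* ε)) (*-pos 0<η (*-pos 0<ε 0<ε))
    in N ℕ.⊔ M , λ m n p q →
      recip⁺-close (seq x m ℚ.⊔ ε) (seq x n ℚ.⊔ ε) 0<ε
        (<-⊔ (seq x m) 0<ε) (<-⊔ (seq x n) 0<ε)
        (ℚ.p≤q⊔p (seq x m) ε) (ℚ.p≤q⊔p (seq x n) ε)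
        (subst₂ (λ u v → ℚ.∣ u ℚ.- v ∣ ℚ.< η ℚ.* (ε ℚ.* ε))
          (sym (⊔-absorb (ε≤x n (ℕ.m⊔n≤o⇒m≤o N M q))))
          (sym (⊔-absorb (ε≤x m (ℕ.m⊔n≤o⇒m≤o N M p))))
          (xδ n m (ℕ.m⊔n≤o⇒n≤o N M q) (ℕ.m⊔n≤o⇒n≤o N M p)))

  ≈-eventually : ∀ {x y} N → (∀ n → N ℕ.≤ n → seq x n ≡ seq y n) → x ≈ y
  ≈-eventually {x} {y} N h = not< {x} {y} (λ n p → sym (h n p)) , not< {y} {x} h
    where
    not< : ∀ {x y} → (∀ n → N ℕ.≤ n → seq y n ≡ seq x n) → ¬ (y < x)
    not< {x} {y} h (ε , 0<ε , M , y+ε≤x) = ℚ.<-irrefl (ℚ.+-identityʳ (seq y (N ℕ.⊔ M)))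
      (ℚ.<-≤-trans (ℚ.+-monoʳ-< (seq y (N ℕ.⊔ M)) 0<ε)
        (subst (seq y (N ℕ.⊔ M) ℚ.+ ε ℚ.≤_) (sym (h (N ℕ.⊔ M) (ℕ.m≤m⊔n N M)))
          (y+ε≤x (N ℕ.⊔ M) (ℕ.m≤n⊔m N M))))

open Construction

_+_ : ℝ → ℝ → ℝ
x + y = mkℝ (λ n → seq x n ℚ.+ seq y n) (+-cauchy x y)

_*_ : ℝ → ℝ → ℝ
x * y = mkℝ (λ n → seq x n ℚ.* seq y n) (*-cauchy x y)

-- If x is eventually at least ε > 0, then replacing each term by its
-- maximum with ε changes only finitely many terms and makes every term
-- invertible.

recip : (x : ℝ) → 0ℝ < x → ℝ
recip x (ε , 0<ε , N , ε≤x) =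
  mkℝ (truncRecip x ε 0<ε) (truncRecip-cauchy x ε 0<ε N ε≤x)

*-recip : ∀ x (0<x : 0ℝ < x) → x * recip x 0<x ≈ 1ℝ
*-recip x 0<x@(ε , 0<ε , N , ε≤x) =
  ≈-eventually {x * recip x 0<x} {1ℝ} N λ n N≤n → trans
    (cong (ℚ._* truncRecip x ε 0<ε n) (sym (⊔-absorb (ε≤x n N≤n))))
    (recip⁺-inverseʳ (seq x n ℚ.⊔ ε) (<-⊔ (seq x n) 0<ε))

record Instance : Set₁ where
  field
    𝒰   : Set
    _≟_ : DecidableEquality 𝒰
    ν   : 𝒰 → ℝ
    ν≥0 : ∀ u → 0ℝ ≤ ν u

  Ω : Set
  Ω = 𝒰 × ℕ

  -- The list stands for a finite set, so it should be free of repetitions.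
  ν[_] : List 𝒰 → ℝ
  ν[_] = foldr (λ u s → ν u + s) 0ℝ

open Instance public using (𝒰; Ω; ν; ν≥0)

-- A sequence of arrivals is a vector with the most recent arrival first,
-- so the tail of the vector is the past.  As the arrivals are distinct,
-- a set of arrived elements is a subset of the positions.

Arrivals : Instance → ℕ → Set
Arrivals I n = Vec (Ω I) n

elements : ∀ {A : Set} {n} → Vec A n → Subset n → List A
elements []       []            = []
elements (x ∷ xs) (inside  ∷ S) = x ∷ elements xs S
elements (x ∷ xs) (outside ∷ S) = elements xs S

-- Deduplication is what makes an item selected through several parts
-- count only once.

f : (I : Instance) → ∀ {n} → Arrivals I n → Subset n → ℝ
f I xs S = ν[ deduplicate _≟_ (map proj₁ (elements xs S)) ]
  where open Instance I

part : ∀ {U : Set} {n} → ℕ → Vec (U × ℕ) n → Subset n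
part i = Vec.map (λ e → does (proj₂ e ℕ.≟ i))

Independent : ∀ {U : Set} {n} → Vec (U × ℕ) n → Subset n → Set
Independent xs S = ∀ i → ∣ S ∩ part i xs ∣ ℕ.≤ 1

private
  emptyOrHit : ∀ {U : Set} {n} i (xs : Vec (U × ℕ) n) S →
    ∣ S ∩ part i xs ∣ ≡ 0 ⊎ ∃[ k ] proj₂ (lookup xs k) ≡ i
  emptyOrHit i []       []      = inj₁ refl
  emptyOrHit i (x ∷ xs) (b ∷ S) with proj₂ x ℕ.≡ᵇ i in eq | emptyOrHit i xs S
  emptyOrHit i (x ∷ xs) (b ∷ S)       | true  | _              =
    inj₂ (zero , ℕ.≡ᵇ⇒≡ (proj₂ x) i (subst T (sym eq) _))
  emptyOrHit i (x ∷ xs) (b ∷ S)       | false | inj₂ (k , hit) = inj₂ (suc k , hit)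
  emptyOrHit i (x ∷ xs) (inside ∷ S)  | false | inj₁ e         = inj₁ e
  emptyOrHit i (x ∷ xs) (outside ∷ S) | false | inj₁ e         = inj₁ e

independent? : ∀ {U : Set} {n} (xs : Vec (U × ℕ) n) S → Dec (Independent xs S)
independent? xs S = map′ everywhere (λ ind k → ind (proj₂ (lookup xs k)))
    (all? λ k → ∣ S ∩ part (proj₂ (lookup xs k)) xs ∣ ℕ.≤? 1)
  where
  everywhere : (∀ k → ∣ S ∩ part (proj₂ (lookup xs k)) xs ∣ ℕ.≤ 1) → Independent xs S
  everywhere h i with emptyOrHit i xs S
  ... | inj₁ e          = subst (ℕ._≤ 1) (sym e) z≤n
  ... | inj₂ (k , refl) = h k

IsOPT : (I : Instance) → ∀ {n} → Arrivals I n → Subset n → Set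
IsOPT I xs T = Independent xs T × (∀ T′ → Independent xs T′ → f I xs T′ ≤ f I xs T)

-- What is revealed after n arrivals: both oracles, on sets of arrived
-- elements.  The elements themselves are known only by order of arrival.

record Oracles (n : ℕ) : Set where
  field
    value       : Subset n → ℝ
    independent : Subset n → Bool

open Oracles public

oracles : (I : Instance) → ∀ {n} → Arrivals I n → Oracles n
oracles I xs .value         = f I xs
oracles I xs .independent S = does (independent? xs S)

infix 4 _≈ₒ_

_≈ₒ_ : ∀ {n} → Oracles n → Oracles n → Set
O ≈ₒ O′ = ∀ S → value O S ≈ value O′ S × independent O S ≡ independent O′ S

-- Given the oracles (including the new arrival) and the current solution,
-- a rule says whether to include the new arrival and which old elements
-- need not be removed.  Earlier oracles are restrictions of the present
-- ones, so this is all the information available to the algorithm.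

Rule : Set
Rule = ∀ {n} → Oracles (suc n) → Subset n → Bool × Subset n

-- Intersecting with the current solution prevents the retrieval of
-- rejected or removed elements.

run : Rule → (I : Instance) → ∀ {n} → Arrivals I n → Subset n
run ρ I []       = []
run ρ I (e ∷ xs) =
  let (include , keep) = ρ (oracles I (e ∷ xs)) (run ρ I xs)
  in include ∷ (run ρ I xs ∩ keep)

record Algorithm : Set₁ where
  field
    rule     : Rule
    -- Equality of reals is not _≡_, so it must be required that decisions
    -- depend only on the values, not on their representing sequences.
    respects : ∀ {n} {O O′ : Oracles (suc n)} → O ≈ₒ O′ →
               ∀ S → rule O S ≡ rule O′ S
    feasible : ∀ (I : Instance) {n} (xs : Arrivals I n) → Unique xs →
               Independent xs (run rule I xs)

  solution : (I : Instance) → ∀ {n} → Arrivals I n → Subset n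
  solution = run rule

open Algorithm public

StrictlyMonotone : Algorithm → Set₁
StrictlyMonotone A = ∀ (I : Instance) {n} (e : Ω I) (xs : Arrivals I n) →
  Unique (e ∷ xs) →
  Vec.head (solution A I (e ∷ xs)) ≡ inside →
  f I xs (solution A I xs) < f I (e ∷ xs) (solution A I (e ∷ xs))

HasCompetitiveRatio : Algorithm → ℝ → Set₁
HasCompetitiveRatio A r = ∀ (I : Instance) {n} (xs : Arrivals I n) → Unique xs →
  ∀ T → IsOPT I xs T → r * f I xs T ≤ f I xs (solution A I xs)

{-# OPTIONS --safe #-}
module Submission where

-- Items 0, 1, 2, ... of weights w 0, w 1, ... are offered as follows.  Item k
-- first appears in part 0, where all items compete for one slot, and
-- then once more as a duplicate in its private part k + 1.  Suppose
-- item k has just been accepted in part 0.  Its duplicate adds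
-- nothing to f, so a strictly monotone algorithm must reject it; but when
-- item k + 1 then takes over the slot in part 0, item k is lost for good.
-- So the algorithm never holds more than the last accepted item, whereas
-- the optimum holds all items: the newest in part 0, the others in their
-- private parts.
--
-- With W k = w 0 + ... + w (k - 1), rejecting item k + 1 leaves
-- the algorithm with w k = W (k + 1) - W k against W (k + 2).  Choosing
-- W (k + 2) = α (W (k + 1) - W k) makes every such rejection fatal, and for
-- α < 4 the characteristic polynomial x² - α x + α has no real root, so
-- that these weights cannot remain positive: the algorithm is finally driven
-- into accepting an item that is too light.  Instead of this
-- oscillating solution, a perturbation of the solution for α = 4 is used,
--
--   W k = 2 ^ k * k * (m + 2 - k),   w k = 2 ^ k * (2 + (k + 2) * (m - k)).
--
-- Then 4 * w k - W (k + 2) = 8 * 2 ^ k, while w k is at least m * 2 ^ k, so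
-- when α + ε ≤ 4 and m is at least 8 / ε the rejection of item k + 1 is fatal
-- for every k < m (deficit, weight-≥); rejecting item 0 leaves nothing at
-- all.  Having accepted item m, the algorithm holds 2 ^ (m + 1) against
-- (m + 1) * 2 ^ (m + 1), which is fatal as well when m ≥ 3 (last-weight).
--
-- The online argument is not-competitive, for arbitrary weights and with the
-- fatal comparisons as hypotheses; loses turns an inequality between natural
-- numbers into such a comparison.

open import Defs
open import Data.Bool using (true; false)
open import Data.Fin.Subset using (Subset; inside; outside; _∩_; ∣_∣)
open import Data.Integer as ℤ using (+_)
import Data.Integer.Properties as ℤ
open import Data.List using (List; []; _∷_; [_]; _++_; foldr; map; filter; length; deduplicate; downFrom)
open import Data.List.Membership.Propositional using (_∈_)
open import Data.List.Membership.Propositional.Properties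
open import Data.List.Properties using (filter-accept; filter-reject; filter-none)
open import Data.List.Relation.Binary.Permutation.Propositional.Properties as ↭ using (shift; ∈-resp-↭)
open import Data.List.Relation.Binary.Subset.Propositional using (_⊆_)
import Data.List.Relation.Binary.Subset.Propositional.Properties as ⊆
open import Data.List.Relation.Unary.All as All using (All; []; _∷_)
open import Data.List.Relation.Unary.AllPairs using ([]; _∷_)
open import Data.List.Relation.Unary.Any using (here; there)
open import Data.List.Relation.Unary.Unique.DecPropositional.Properties using (deduplicate-!)
open import Data.List.Relation.Unary.Unique.Propositional using (Unique)
open import Data.List.Relation.Unary.Unique.Propositional.Properties using (downFrom⁺)
  renaming (map⁺ to Unique-map⁺)
open import Data.Nat as ℕ using (ℕ; zero; suc; z≤n; s≤s)
import Data.Nat.Properties as ℕ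
open import Data.Nat.ListAction using (sum)
open import Data.Nat.ListAction.Properties using (sum-↭)
import Data.Nat.Solver as ℕ-Solver
open import Data.Product using (∃-syntax; _×_; _,_; proj₁; proj₂)
open import Data.Rational as ℚ using (ℚ; 0ℚ; 1ℚ; _/_; toℚᵘ)
import Data.Rational.Properties as ℚ
open import Data.Rational.Unnormalised as ℚᵘ using (mkℚᵘ; *≡*; *≤*)
import Data.Rational.Unnormalised.Properties as ℚᵘ
open import Data.Vec as Vec using (Vec; []; _∷_)
import Data.Vec.Relation.Unary.All as VecAll
import Data.Vec.Relation.Unary.AllPairs as VecPairs
import Data.Vec.Relation.Unary.Unique.Propositional as VecUnique
open import Function using (_∘_)
open import Relation.Binary.PropositionalEquality
  using (_≡_; _≢_; refl; sym; trans; cong; cong₂; subst; subst₂; module ≡-Reasoning)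
open import Relation.Nullary using (¬_; yes; no; contradiction)

open Construction using (*-pos; *-mono; recip⁺-pos; recip⁺-inverseʳ; ⊔-absorb; *-swap; <-⊔; recip⁺)

-- Sums and counts over repetition-free lists

sum-mono-⊆ : ∀ (w : ℕ → ℕ) {us vs} → Unique us → us ⊆ vs →
             sum (map w us) ℕ.≤ sum (map w vs)
sum-mono-⊆ w {[]}             _            _     = z≤n
sum-mono-⊆ w {u ∷ us} {vs} (u∉us ∷ us!) us⊆vs with ∈-∃++ (us⊆vs (here refl))
... | ys , zs , refl = begin
  w u ℕ.+ sum (map w us)          ≤⟨ ℕ.+-monoʳ-≤ (w u) (sum-mono-⊆ w us! us⊆rest) ⟩
  w u ℕ.+ sum (map w (ys ++ zs))  ≡⟨ sum-↭ (↭.map⁺ w (shift u ys zs)) ⟨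
  sum (map w (ys ++ [ u ] ++ zs)) ∎
  where
  open ℕ.≤-Reasoning
  us⊆rest : us ⊆ ys ++ zs
  us⊆rest x∈us with ∈-resp-↭ (shift u ys zs) (us⊆vs (there x∈us))
  ... | here refl    = contradiction refl (All.lookup u∉us x∈us)
  ... | there x∈rest = x∈rest

length-filter-≟ : ∀ i {ps} → Unique ps → length (filter (ℕ._≟ i) ps) ℕ.≤ 1
length-filter-≟ i {[]}     _            = z≤n
length-filter-≟ i {p ∷ ps} (p∉ps ∷ ps!) with p ℕ.≟ i
... | no p≢i rewrite filter-reject (ℕ._≟ i) {xs = ps} p≢i = length-filter-≟ i ps!
... | yes refl rewrite filter-accept (ℕ._≟ p) {xs = ps} refl
                     | filter-none (ℕ._≟ p) (All.map (_∘ sym) p∉ps) = ℕ.≤-refl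

-- Selected elements and independence

module _ {U : Set} where

  elements-∩ : ∀ {n} (xs : Vec U n) S K → elements xs (S ∩ K) ⊆ elements xs S
  elements-∩ []       []            []            e∈        = e∈
  elements-∩ (x ∷ xs) (inside ∷ S)  (inside ∷ K)  (here p)  = here p
  elements-∩ (x ∷ xs) (inside ∷ S)  (inside ∷ K)  (there p) = there (elements-∩ xs S K p)
  elements-∩ (x ∷ xs) (inside ∷ S)  (outside ∷ K) p         = there (elements-∩ xs S K p)
  elements-∩ (x ∷ xs) (outside ∷ S) (_ ∷ K)       p         = elements-∩ xs S K p

  elements-accept : ∀ {n} x (xs : Vec U n) S → Vec.head S ≡ inside →
                    elements (x ∷ xs) S ≡ x ∷ elements xs (Vec.tail S)
  elements-accept x xs (inside ∷ S) _ = refl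

  elements-reject : ∀ {n} x (xs : Vec U n) S → Vec.head S ≡ outside →
                    elements (x ∷ xs) S ≡ elements xs (Vec.tail S)
  elements-reject x xs (outside ∷ S) _ = refl

  -- The parts of the selected elements, with repetitions.
  parts : ∀ {n} → Vec (U × ℕ) n → Subset n → List ℕ
  parts xs S = map proj₂ (elements xs S)

  -- The items of the selected elements, with repetitions.
  items : ∀ {n} → Vec (U × ℕ) n → Subset n → List U
  items xs S = map proj₁ (elements xs S)

  ∣∩part∣ : ∀ i {n} (xs : Vec (U × ℕ) n) S →
            ∣ S ∩ part i xs ∣ ≡ length (filter (ℕ._≟ i) (parts xs S))
  ∣∩part∣ i []       []            = refl
  ∣∩part∣ i (x ∷ xs) (outside ∷ S) = ∣∩part∣ i xs S
  ∣∩part∣ i (x ∷ xs) (inside ∷ S) with proj₂ x ℕ.≡ᵇ i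
  ... | true  = cong suc (∣∩part∣ i xs S)
  ... | false = ∣∩part∣ i xs S

  unique-parts⇒independent : ∀ {n} (xs : Vec (U × ℕ) n) S →
                             Unique (parts xs S) → Independent xs S
  unique-parts⇒independent xs S ps! i =
    subst (ℕ._≤ 1) (sym (∣∩part∣ i xs S)) (length-filter-≟ i ps!)

  -- If the newest element x is selected, then no other selected element lies in its part.
  independent⇒fresh-part : ∀ {n} x (xs : Vec (U × ℕ) n) S →
    Vec.head S ≡ inside → Independent (x ∷ xs) S →
    ∀ {e} → e ∈ elements xs (Vec.tail S) → proj₂ e ≢ proj₂ x
  independent⇒fresh-part x xs (inside ∷ S) _ ind e∈ refl
    with subst (ℕ._≤ 1)
           (trans (∣∩part∣ (proj₂ x) (x ∷ xs) (inside ∷ S))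
                  (cong length (filter-accept (ℕ._≟ proj₂ x) {xs = parts xs S} refl)))
           (ind (proj₂ x))
  ... | s≤s len≤0 = ℕ.<⇒≱
    (∈-length (∈-filter⁺ (ℕ._≟ proj₂ x) (∈-map⁺ proj₂ e∈) refl)) len≤0

-- Natural numbers as rationals

-- Made opaque because the normalisation of fractions would otherwise be
-- unfolded whenever two such rationals are compared.
opaque
  fromℕ : ℕ → ℚ
  fromℕ n = + n / 1

  toℚᵘ-fromℕ : ∀ n → toℚᵘ (fromℕ n) ℚᵘ.≃ mkℚᵘ (+ n) 0
  toℚᵘ-fromℕ n = ℚ.toℚᵘ-fromℚᵘ (mkℚᵘ (+ n) 0)

  fromℕ-+ : ∀ a b → fromℕ (a ℕ.+ b) ≡ fromℕ a ℚ.+ fromℕ b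
  fromℕ-+ a b = ℚ.toℚᵘ-injective (begin
    toℚᵘ (fromℕ (a ℕ.+ b))                ≈⟨ toℚᵘ-fromℕ (a ℕ.+ b) ⟩
    mkℚᵘ (+ (a ℕ.+ b)) 0
      ≈⟨ *≡* (cong (ℤ._* + 1) (cong₂ ℤ._+_ (sym (ℤ.*-identityʳ (+ a))) (sym (ℤ.*-identityʳ (+ b))))) ⟩
    mkℚᵘ (+ a) 0 ℚᵘ.+ mkℚᵘ (+ b) 0        ≈⟨ ℚᵘ.+-cong (toℚᵘ-fromℕ a) (toℚᵘ-fromℕ b) ⟨
    toℚᵘ (fromℕ a) ℚᵘ.+ toℚᵘ (fromℕ b)    ≈⟨ ℚ.toℚᵘ-homo-+ (fromℕ a) (fromℕ b) ⟨
    toℚᵘ (fromℕ a ℚ.+ fromℕ b)            ∎)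
    where open ℚᵘ.≃-Reasoning

  fromℕ-* : ∀ a b → fromℕ (a ℕ.* b) ≡ fromℕ a ℚ.* fromℕ b
  fromℕ-* a b = ℚ.toℚᵘ-injective (begin
    toℚᵘ (fromℕ (a ℕ.* b))                ≈⟨ toℚᵘ-fromℕ (a ℕ.* b) ⟩
    mkℚᵘ (+ (a ℕ.* b)) 0                  ≈⟨ *≡* (cong (ℤ._* + 1) (ℤ.pos-* a b)) ⟩
    mkℚᵘ (+ a) 0 ℚᵘ.* mkℚᵘ (+ b) 0        ≈⟨ ℚᵘ.*-cong (toℚᵘ-fromℕ a) (toℚᵘ-fromℕ b) ⟨
    toℚᵘ (fromℕ a) ℚᵘ.* toℚᵘ (fromℕ b)    ≈⟨ ℚ.toℚᵘ-homo-* (fromℕ a) (fromℕ b) ⟨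
    toℚᵘ (fromℕ a ℚ.* fromℕ b)            ∎)
    where open ℚᵘ.≃-Reasoning

  fromℕ-mono-≤ : ∀ {a b} → a ℕ.≤ b → fromℕ a ℚ.≤ fromℕ b
  fromℕ-mono-≤ {a} {b} a≤b = ℚ.toℚᵘ-cancel-≤ (begin
    toℚᵘ (fromℕ a)  ≃⟨ toℚᵘ-fromℕ a ⟩
    mkℚᵘ (+ a) 0    ≤⟨ *≤* (ℤ.*-monoʳ-≤-nonNeg (+ 1) (ℤ.+≤+ a≤b)) ⟩
    mkℚᵘ (+ b) 0    ≃⟨ toℚᵘ-fromℕ b ⟨
    toℚᵘ (fromℕ b)  ∎)
    where open ℚᵘ.≤-Reasoning

  fromℕ-0 : fromℕ 0 ≡ 0ℚ
  fromℕ-0 = refl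

  fromℕ-1 : fromℕ 1 ≡ 1ℚ
  fromℕ-1 = refl

  fromℕ-4 : fromℕ 4 ≡ + 4 / 1
  fromℕ-4 = refl

0≤fromℕ : ∀ n → 0ℚ ℚ.≤ fromℕ n
0≤fromℕ n = subst (ℚ._≤ fromℕ n) fromℕ-0 (fromℕ-mono-≤ z≤n)

0<fromℕ : ∀ {n} → 0 ℕ.< n → 0ℚ ℚ.< fromℕ n
0<fromℕ {n} 0<n = ℚ.<-≤-trans (ℚ.positive⁻¹ 1ℚ)
  (subst (ℚ._≤ fromℕ n) fromℕ-1 (fromℕ-mono-≤ 0<n))

-- The multiplier a * d works for ε = c / d, since c ≥ 1.
archimedean : ∀ a ε → 0ℚ ℚ.< ε → ∃[ n ] fromℕ a ℚ.≤ fromℕ n ℚ.* ε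
archimedean a ε@(ℚ.mkℚ (+ zero) d-1 _) 0<ε = contradiction (ℚ.positive 0<ε) λ ()
archimedean a ε@(ℚ.mkℚ ℤ.-[1+ _ ] d-1 _) 0<ε = contradiction (ℚ.positive 0<ε) λ ()
archimedean a ε@(ℚ.mkℚ (+ suc num-1) d-1 _) 0<ε = n , ℚ.toℚᵘ-cancel-≤ (begin
  toℚᵘ (fromℕ a)             ≃⟨ toℚᵘ-fromℕ a ⟩
  mkℚᵘ (+ a) 0               ≤⟨ *≤* (subst₂ ℤ._≤_ (ℤ.pos-* a (1 ℕ.* suc d-1))
                                   (trans (ℤ.pos-* (n ℕ.* suc num-1) 1)
                                          (cong (ℤ._* + 1) (ℤ.pos-* n (suc num-1))))
                                   (ℤ.+≤+ bound)) ⟩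
  mkℚᵘ (+ n) 0 ℚᵘ.* toℚᵘ ε   ≃⟨ ℚᵘ.*-congʳ {toℚᵘ ε} (toℚᵘ-fromℕ n) ⟨
  toℚᵘ (fromℕ n) ℚᵘ.* toℚᵘ ε ≃⟨ ℚ.toℚᵘ-homo-* (fromℕ n) ε ⟨
  toℚᵘ (fromℕ n ℚ.* ε)       ∎)
  where
  open ℚᵘ.≤-Reasoning
  n = a ℕ.* suc d-1
  bound : a ℕ.* (1 ℕ.* suc d-1) ℕ.≤ n ℕ.* suc num-1 ℕ.* 1
  bound = subst₂ ℕ._≤_ (cong (a ℕ.*_) (sym (ℕ.*-identityˡ (suc d-1)))) (sym (ℕ.*-identityʳ _))
            (ℕ.m≤m*n n (suc num-1))

-- Reals that are natural numbers

-- x is the constant sequence with value a.  This is stronger than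
-- x ≈ fromℚ (fromℕ a), and holds of every value of f when the weights
-- are natural numbers.  A record, so that x and a can be inferred from it.
record Represents (x : ℝ) (a : ℕ) : Set where
  constructor represents
  field everywhere : ∀ j → seq x j ≡ fromℕ a

represents-fromℕ : ∀ a → Represents (fromℚ (fromℕ a)) a
represents-fromℕ a = represents λ _ → refl

represents-0 : Represents 0ℝ 0
represents-0 = represents λ _ → sym fromℕ-0

represents-+ : ∀ x y {a b} → Represents x a → Represents y b → Represents (x + y) (a ℕ.+ b)
represents-+ x y {a} {b} (represents x≡a) (represents y≡b) = represents λ j →
  trans (cong₂ ℚ._+_ (x≡a j) (y≡b j)) (sym (fromℕ-+ a b))

represents-foldr : ∀ {U : Set} {g : U → ℝ → ℝ} {w : U → ℕ} →
  (∀ u {x a} → Represents x a → Represents (g u x) (w u ℕ.+ a)) →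
  ∀ us → Represents (foldr g 0ℝ us) (sum (map w us))
represents-foldr step []       = represents-0
represents-foldr step (u ∷ us) = step u (represents-foldr step us)

represents-mono : ∀ {x y a b} → Represents x a → Represents y b → a ℕ.≤ b → x ≤ y
represents-mono {x} {y} {a} {b} (represents x≡a) (represents y≡b) a≤b (ε , 0<ε , N , y+ε≤x) =
  ℚ.<-irrefl refl (begin-strict
    fromℕ b             ≡⟨ ℚ.+-identityʳ (fromℕ b) ⟨
    fromℕ b ℚ.+ 0ℚ      <⟨ ℚ.+-monoʳ-< (fromℕ b) 0<ε ⟩
    fromℕ b ℚ.+ ε       ≡⟨ cong (ℚ._+ ε) (y≡b N) ⟨
    seq y N ℚ.+ ε       ≤⟨ y+ε≤x N ℕ.≤-refl ⟩
    seq x N             ≡⟨ x≡a N ⟩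
    fromℕ a             ≤⟨ fromℕ-mono-≤ a≤b ⟩
    fromℕ b             ∎)
  where open ℚ.≤-Reasoning

-- Comparing an algorithm with the optimum

+-cancelʳ-≤ : ∀ r p q → p ℚ.+ r ℚ.≤ q ℚ.+ r → p ℚ.≤ q
+-cancelʳ-≤ r p q p+r≤q+r = ℚ.≮⇒≥ λ q<p →
  ℚ.<-irrefl refl (ℚ.<-≤-trans (ℚ.+-monoˡ-< r q<p) p+r≤q+r)

-- For values in the natural numbers: an algorithm whose value is at most s violates
-- the ratio r as soon as the optimum is at least t.
Loses : ℝ → ℕ → ℕ → Set
Loses r s t = ∀ x y {a b} → Represents x a → Represents y b →
              a ℕ.≤ s → t ℕ.≤ b → x < r * y

-- With 1 / α < r and α + ε ≤ 4, the hypothesis on s and t amounts to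
-- (4 - ε) * s ≤ t, so that r * t exceeds s.
loses : ∀ α {0<α} r {ε N} → (∀ n → N ℕ.≤ n → seq α n ℚ.+ ε ℚ.≤ fromℕ 4) → recip α 0<α < r →
        ∀ s t → 0 ℕ.< t → fromℕ 4 ℚ.* fromℕ s ℚ.≤ fromℕ t ℚ.+ ε ℚ.* fromℕ s → Loses r s t
loses α {δ , 0<δ , N₀ , δ≤α} r {ε} {N} α+ε≤4 (η , 0<η , N₁ , α⁻¹+η≤r) s t 0<t 4s≤t+εs
      x y (represents x≡a) (represents y≡b) a≤s t≤b =
  η ℚ.* fromℕ t , *-pos 0<η 0<t′ , N ℕ.⊔ (N₀ ℕ.⊔ N₁) , bound
  where
  open ℚ.≤-Reasoning
  0<t′ = 0<fromℕ 0<t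

  x≤s : ∀ n → seq x n ℚ.≤ fromℕ s
  x≤s n = subst (ℚ._≤ fromℕ s) (sym (x≡a n)) (fromℕ-mono-≤ a≤s)

  t≤y : ∀ n → fromℕ t ℚ.≤ seq y n
  t≤y n = subst (fromℕ t ℚ.≤_) (sym (y≡b n)) (fromℕ-mono-≤ t≤b)

  bound : ∀ n → N ℕ.⊔ (N₀ ℕ.⊔ N₁) ℕ.≤ n →
          seq x n ℚ.+ η ℚ.* fromℕ t ℚ.≤ seq r n ℚ.* seq y n
  bound n big = begin
    seq x n ℚ.+ η ℚ.* fromℕ t      ≤⟨ ℚ.+-monoˡ-≤ (η ℚ.* fromℕ t) (ℚ.≤-trans (x≤s n) s≤ct) ⟩
    c ℚ.* fromℕ t ℚ.+ η ℚ.* fromℕ t  ≡⟨ ℚ.*-distribʳ-+ (fromℕ t) c η ⟨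
    (c ℚ.+ η) ℚ.* fromℕ t          ≤⟨ *-mono (ℚ.<⇒≤ (ℚ.+-mono-< 0<c 0<η))
                                        (ℚ.≤-trans (ℚ.<⇒≤ 0<t′) (t≤y n))
                                        (α⁻¹+η≤r n (ℕ.m⊔n≤o⇒n≤o N₀ N₁ (ℕ.m⊔n≤o⇒n≤o N _ big))) (t≤y n) ⟩
    seq r n ℚ.* seq y n            ∎
    where
    -- For n beyond the moduli, a is the n-th term of α and c that of its reciprocal.
    a = seq α n ℚ.⊔ δ
    0<a = <-⊔ (seq α n) 0<δ
    c = recip⁺ a 0<a
    0<c = recip⁺-pos a 0<a

    a≡α : a ≡ seq α n
    a≡α = ⊔-absorb (δ≤α n (ℕ.m⊔n≤o⇒m≤o N₀ N₁ (ℕ.m⊔n≤o⇒n≤o N _ big)))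

    as≤t : a ℚ.* fromℕ s ℚ.≤ fromℕ t
    as≤t = +-cancelʳ-≤ (ε ℚ.* fromℕ s) _ _ (begin
      a ℚ.* fromℕ s ℚ.+ ε ℚ.* fromℕ s  ≡⟨ ℚ.*-distribʳ-+ (fromℕ s) a ε ⟨
      (a ℚ.+ ε) ℚ.* fromℕ s            ≡⟨ cong (λ z → (z ℚ.+ ε) ℚ.* fromℕ s) a≡α ⟩
      (seq α n ℚ.+ ε) ℚ.* fromℕ s      ≤⟨ ℚ.*-monoʳ-≤-nonNeg (fromℕ s) {{ℚ.nonNegative (0≤fromℕ s)}}
                                            (α+ε≤4 n (ℕ.m⊔n≤o⇒m≤o N _ big)) ⟩
      fromℕ 4 ℚ.* fromℕ s              ≤⟨ 4s≤t+εs ⟩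
      fromℕ t ℚ.+ ε ℚ.* fromℕ s        ∎)

    s≤ct : fromℕ s ℚ.≤ c ℚ.* fromℕ t
    s≤ct = begin
      fromℕ s                ≡⟨ ℚ.*-identityʳ (fromℕ s) ⟨
      fromℕ s ℚ.* 1ℚ         ≡⟨ cong (fromℕ s ℚ.*_) (trans (sym (recip⁺-inverseʳ a 0<a)) (ℚ.*-comm a c)) ⟩
      fromℕ s ℚ.* (c ℚ.* a)  ≡⟨ trans (*-swap (fromℕ s) c a) (cong (c ℚ.*_) (ℚ.*-comm (fromℕ s) a)) ⟩
      c ℚ.* (a ℚ.* fromℕ s)  ≤⟨ ℚ.*-monoˡ-≤-nonNeg c {{ℚ.nonNegative (ℚ.<⇒≤ 0<c)}} as≤t ⟩
      c ℚ.* fromℕ t          ∎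

-- The sequence of arrivals

-- The items are the natural numbers.
weighted : (ℕ → ℕ) → Instance
weighted w = record
  { 𝒰 = ℕ ; _≟_ = ℕ._≟_ ; ν = fromℚ ∘ fromℕ ∘ w
  ; ν≥0 = λ u (ε , 0<ε , N , h) → ℚ.<-irrefl refl
      (ℚ.<-≤-trans (ℚ.+-mono-≤-< (0≤fromℕ (w u)) 0<ε) (h N ℕ.≤-refl)) }

-- All items below k have arrived, both in part 0 and in their private parts.
arrivals : ∀ k → Vec (ℕ × ℕ) (k ℕ.* 2)
arrivals zero    = []
arrivals (suc k) = (k , suc k) ∷ (k , 0) ∷ arrivals k

-- Item k has moreover arrived in part 0, where it contests the slot.
contest : ∀ k → Vec (ℕ × ℕ) (suc (k ℕ.* 2))
contest k = (k , 0) ∷ arrivals k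

arrivals-items< : ∀ k → VecAll.All (λ e → proj₁ e ℕ.< k) (arrivals k)
arrivals-items< zero    = VecAll.[]
arrivals-items< (suc k) =
  ℕ.≤-refl VecAll.∷ ℕ.≤-refl VecAll.∷ VecAll.map ℕ.m<n⇒m<1+n (arrivals-items< k)

fresh : ∀ k i → VecAll.All ((k , i) ≢_) (arrivals k)
fresh k i = VecAll.map (λ e<k k≡e → ℕ.<-irrefl (sym (cong proj₁ k≡e)) e<k) (arrivals-items< k)

arrivals-unique : ∀ k → VecUnique.Unique (arrivals k)
contest-unique : ∀ k → VecUnique.Unique (contest k)

arrivals-unique zero    = VecPairs.[]
arrivals-unique (suc k) = ((λ ()) VecAll.∷ fresh k (suc k)) VecPairs.∷ contest-unique k

contest-unique k = fresh k 0 VecPairs.∷ arrivals-unique k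

elements-All : ∀ {A : Set} {P : A → Set} {n} (xs : Vec A n) S →
               VecAll.All P xs → All P (elements xs S)
elements-All []       []            _                   = []
elements-All (x ∷ xs) (inside ∷ S)  (px VecAll.∷ pxs) = px ∷ elements-All xs S pxs
elements-All (x ∷ xs) (outside ∷ S) (px VecAll.∷ pxs) = elements-All xs S pxs

-- The elements in private parts.
duplicates : ∀ k → Subset (k ℕ.* 2)
duplicates zero    = []
duplicates (suc k) = inside ∷ outside ∷ duplicates k

-- The newest item in part 0 and all others in their private parts.
all-items : ∀ k → Subset (suc (k ℕ.* 2))
all-items k = inside ∷ duplicates k

items-duplicates : ∀ k → items (arrivals k) (duplicates k) ≡ downFrom k
items-duplicates zero    = refl
items-duplicates (suc k) = cong (k ∷_) (items-duplicates k)

parts-duplicates : ∀ k → parts (arrivals k) (duplicates k) ≡ map suc (downFrom k)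
parts-duplicates zero    = refl
parts-duplicates (suc k) = cong (suc k ∷_) (parts-duplicates k)

parts-all-items-unique : ∀ k → Unique (parts (contest k) (all-items k))
parts-all-items-unique k rewrite parts-duplicates k =
  All.tabulate (λ p∈ 0≡p → zero∉map-suc (subst (_∈ _) (sym 0≡p) p∈))
    ∷ Unique-map⁺ ℕ.suc-injective (downFrom⁺ k)
  where
  zero∉map-suc : ∀ {ps} → ¬ (0 ∈ map suc ps)
  zero∉map-suc 0∈ with ∈-map⁻ suc 0∈
  ... | _ , _ , ()

items-contest⊆ : ∀ k S → items (contest k) S ⊆ downFrom (suc k)
items-contest⊆ k S u∈ with ∈-map⁻ proj₁ u∈
... | _ , e∈ , refl = ∈-downFrom⁺
  (All.lookup (elements-All (contest k) S
     (ℕ.≤-refl VecAll.∷ VecAll.map ℕ.m<n⇒m<1+n (arrivals-items< k))) e∈)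

-- The objective, computed in the natural numbers.
value-ℕ : (ℕ → ℕ) → ∀ {n} → Vec (ℕ × ℕ) n → Subset n → ℕ
value-ℕ w xs S = sum (map w (deduplicate ℕ._≟_ (items xs S)))

-- The weight of the items below k.
total : (ℕ → ℕ) → ℕ → ℕ
total w k = sum (map w (downFrom k))

-- What an algorithm can hold when item k is about to arrive: at most the
-- previous item, in part 0.
held : ℕ → List (ℕ × ℕ)
held zero    = []
held (suc k) = [ (k , 0) ]

-- Its weight.
held-weight : (ℕ → ℕ) → ℕ → ℕ
held-weight w zero    = 0
held-weight w (suc k) = w k

module _ (w : ℕ → ℕ) where

  private I = weighted w

  f-represents : ∀ {n} (xs : Arrivals I n) S → Represents (f I xs S) (value-ℕ w xs S)
  f-represents xs S = represents-foldr
    (λ u {x} → represents-+ (ν I u) x (represents-fromℕ (w u)))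
    (deduplicate ℕ._≟_ (items xs S))

  -- As the value is a sum over a deduplicated list, only inclusion of the sets of
  -- items matters.
  value-≤ : ∀ {n} (xs : Arrivals I n) S {us} → items xs S ⊆ us → value-ℕ w xs S ℕ.≤ sum (map w us)
  value-≤ xs S ⊆us = sum-mono-⊆ w (deduplicate-! ℕ._≟_ (items xs S))
    (⊆us ∘ ∈-deduplicate⁻ ℕ._≟_ (items xs S))

  value-≥ : ∀ {n} (xs : Arrivals I n) S {us} → Unique us → us ⊆ items xs S →
            sum (map w us) ℕ.≤ value-ℕ w xs S
  value-≥ xs S us! us⊆ = sum-mono-⊆ w us! (∈-deduplicate⁺ ℕ._≟_ ∘ us⊆)

  downFrom⊆all-items : ∀ k → downFrom (suc k) ⊆ items (contest k) (all-items k)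
  downFrom⊆all-items k = ⊆.⊆-reflexive (cong (k ∷_) (sym (items-duplicates k)))

  all-items-value : ∀ k → total w (suc k) ℕ.≤ value-ℕ w (contest k) (all-items k)
  all-items-value k = value-≥ (contest k) (all-items k) (downFrom⁺ (suc k)) (downFrom⊆all-items k)

  -- Every item that has arrived is selected, so no set has a larger value.
  all-items-optimal : ∀ k → IsOPT I (contest k) (all-items k)
  all-items-optimal k =
      unique-parts⇒independent (contest k) (all-items k) (parts-all-items-unique k)
    , λ T _ → represents-mono (f-represents (contest k) T) (f-represents (contest k) (all-items k))
        (ℕ.≤-trans (value-≤ (contest k) T (items-contest⊆ k T)) (all-items-value k))

  -- A strictly monotone online algorithm

  module _ (A : Algorithm) (strict : StrictlyMonotone A)
           (r : ℝ) (competitive : HasCompetitiveRatio A r) where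

    -- The algorithm selects nothing outside held k after the arrivals xs.
    Holding : ∀ {n} → Arrivals I n → ℕ → Set
    Holding xs k = elements xs (solution A I xs) ⊆ held k

    -- The optimum after contest k contains the items up to k.
    lost : ∀ k j → Holding (contest k) j → ¬ Loses r (held-weight w j) (total w (suc k))
    lost k j holding loss =
      competitive I (contest k) (contest-unique k) (all-items k) (all-items-optimal k)
        (loss _ _ (f-represents (contest k) (solution A I (contest k)))
          (f-represents (contest k) (all-items k)) value≤held (all-items-value k))
      where
      sum-held : ∀ j → sum (map w (map proj₁ (held j))) ≡ held-weight w j
      sum-held zero    = refl
      sum-held (suc j) = ℕ.+-identityʳ (w j)

      value≤held : value-ℕ w (contest k) (solution A I (contest k)) ℕ.≤ held-weight w j
      value≤held = subst (_ ℕ.≤_) (sum-held j)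
        (value-≤ (contest k) (solution A I (contest k)) (⊆.map⁺ proj₁ holding))

    -- Rejected and removed elements are never retrieved.
    tail-⊆ : ∀ {n} e (xs : Arrivals I n) →
             elements xs (Vec.tail (solution A I (e ∷ xs))) ⊆ elements xs (solution A I xs)
    tail-⊆ e xs = elements-∩ xs _ _

    reject-⊆ : ∀ {n} e (xs : Arrivals I n) → Vec.head (solution A I (e ∷ xs)) ≡ outside →
               elements (e ∷ xs) (solution A I (e ∷ xs)) ⊆ elements xs (solution A I xs)
    reject-⊆ e xs out = tail-⊆ e xs ∘ ⊆.⊆-reflexive (elements-reject e xs (solution A I (e ∷ xs)) out)

    -- Strict monotonicity in terms of the natural-number values.
    include⇒gain : ∀ {n} e (xs : Arrivals I n) → VecUnique.Unique (e ∷ xs) →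
      Vec.head (solution A I (e ∷ xs)) ≡ inside →
      ¬ (value-ℕ w (e ∷ xs) (solution A I (e ∷ xs)) ℕ.≤ value-ℕ w xs (solution A I xs))
    include⇒gain e xs distinct inc v≤v =
      represents-mono (f-represents (e ∷ xs) (solution A I (e ∷ xs)))
        (f-represents xs (solution A I xs)) v≤v (strict I e xs distinct inc)

    held-part : ∀ k {e} → e ∈ held k → proj₂ e ≡ 0
    held-part (suc k) (here refl) = refl

    -- By feasibility, the item in part 0 must make way for its successor.
    accept-holding : ∀ k → Holding (arrivals k) k →
      Vec.head (solution A I (contest k)) ≡ inside → Holding (contest k) (suc k)
    accept-holding k holding inc =
      kept ∘ ⊆.⊆-reflexive (elements-accept (k , 0) (arrivals k) (solution A I (contest k)) inc)
      where
      kept : ((k , 0) ∷ elements (arrivals k) (Vec.tail (solution A I (contest k)))) ⊆ held (suc k)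
      kept (here p)   = here p
      kept (there e∈) = contradiction (held-part k (holding (tail-⊆ (k , 0) (arrivals k) e∈)))
        (independent⇒fresh-part (k , 0) (arrivals k) (solution A I (contest k)) inc
          (feasible A I (contest k) (contest-unique k)) e∈)

    contest-accepted : ∀ k → Holding (arrivals k) k →
      Loses r (held-weight w k) (total w (suc k)) →
      Vec.head (solution A I (contest k)) ≡ inside
    contest-accepted k holding loss = go _ refl
      where
      go : ∀ b → Vec.head (solution A I (contest k)) ≡ b → Vec.head (solution A I (contest k)) ≡ inside
      go inside  eq = eq
      go outside eq = contradiction loss (lost k k (holding ∘ reject-⊆ (k , 0) (arrivals k) eq))

    -- Including the duplicate leaves only items that were selected before, so
    -- the value would not increase.
    duplicate-rejected : ∀ k → Vec.head (solution A I (contest k)) ≡ inside →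
      Vec.head (solution A I (arrivals (suc k))) ≡ outside
    duplicate-rejected k inc = go _ refl
      where
      k∈items : k ∈ items (contest k) (solution A I (contest k))
      k∈items = ∈-map⁺ proj₁ (⊆.⊆-reflexive
        (sym (elements-accept (k , 0) (arrivals k) (solution A I (contest k)) inc)) (here refl))

      items⊆ : Vec.head (solution A I (arrivals (suc k))) ≡ inside →
        items (arrivals (suc k)) (solution A I (arrivals (suc k)))
          ⊆ items (contest k) (solution A I (contest k))
      items⊆ inc′ = covered ∘ ⊆.⊆-reflexive (cong (map proj₁)
        (elements-accept (k , suc k) (contest k) (solution A I (arrivals (suc k))) inc′))
        where
        covered : (k ∷ items (contest k) (Vec.tail (solution A I (arrivals (suc k)))))
                    ⊆ items (contest k) (solution A I (contest k))
        covered (here refl) = k∈items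
        covered (there u∈)  = ⊆.map⁺ proj₁ (tail-⊆ (k , suc k) (contest k)) u∈

      go : ∀ b → Vec.head (solution A I (arrivals (suc k))) ≡ b →
           Vec.head (solution A I (arrivals (suc k))) ≡ outside
      go outside eq = eq
      go inside  eq = contradiction
        (value-≤ (arrivals (suc k)) (solution A I (arrivals (suc k))) (∈-deduplicate⁺ ℕ._≟_ ∘ items⊆ eq))
        (include⇒gain (k , suc k) (contest k) (arrivals-unique (suc k)) eq)

    -- The main invariant: as long as rejection is fatal, every contested item is
    -- accepted and its duplicate rejected.  The algorithm might still drop item k
    -- when the duplicate arrives, hence an inclusion and not an equality in Holding.
    arrivals-holding : ∀ k →
      (∀ j → j ℕ.< k → Loses r (held-weight w j) (total w (suc j))) →
      Holding (arrivals k) k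
    arrivals-holding zero    _    = λ ()
    arrivals-holding (suc k) loss =
      contested ∘ reject-⊆ (k , suc k) (contest k) (duplicate-rejected k inc)
      where
      before    = arrivals-holding k (λ j j<k → loss j (ℕ.m<n⇒m<1+n j<k))
      inc       = contest-accepted k before (loss k ℕ.≤-refl)
      contested = accept-holding k before inc

    -- If rejecting any of the items up to m is fatal, and so is holding only item m
    -- when all these items have arrived, then the algorithm is not competitive.
    not-competitive : ∀ m →
      (∀ j → j ℕ.≤ m → Loses r (held-weight w j) (total w (suc j))) →
      ¬ Loses r (w m) (total w (suc m))
    not-competitive m loss = lost m (suc m)
      (accept-holding m before (contest-accepted m before (loss m ℕ.≤-refl)))
      where
      before = arrivals-holding m (λ j j<m → loss j (ℕ.<⇒≤ j<m))

-- The weights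

-- The formula is meant for k ≤ m.
weight : ℕ → ℕ → ℕ
weight m k = 2 ℕ.^ k ℕ.* (2 ℕ.+ (2 ℕ.+ k) ℕ.* (m ℕ.∸ k))

weight-+ : ∀ k l → weight (k ℕ.+ l) k ≡ 2 ℕ.^ k ℕ.* (2 ℕ.+ (2 ℕ.+ k) ℕ.* l)
weight-+ k l = cong (λ d → 2 ℕ.^ k ℕ.* (2 ℕ.+ (2 ℕ.+ k) ℕ.* d)) (ℕ.m+n∸m≡n k l)

open ℕ-Solver.+-*-Solver using (solve; con; _:=_; _:+_; _:*_)

-- The closed form 2 ^ k * k * (m + 2 - k), for k ≤ m + 1.
total-weight : ∀ m k l → k ℕ.+ l ≡ suc m →
               total (weight m) k ≡ 2 ℕ.^ k ℕ.* (k ℕ.* suc l)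
total-weight m zero    l _  = refl
total-weight m (suc k) l refl = begin
  weight (k ℕ.+ l) k ℕ.+ total (weight (k ℕ.+ l)) k
    ≡⟨ cong₂ ℕ._+_ (weight-+ k l) (total-weight (k ℕ.+ l) k (suc l) (ℕ.+-suc k l)) ⟩
  2 ℕ.^ k ℕ.* (2 ℕ.+ (2 ℕ.+ k) ℕ.* l) ℕ.+ 2 ℕ.^ k ℕ.* (k ℕ.* (2 ℕ.+ l))
    ≡⟨ solve 3 (λ p k l → p :* (con 2 :+ (con 2 :+ k) :* l) :+ p :* (k :* (con 2 :+ l))
                  := (con 2 :* p) :* ((con 1 :+ k) :* (con 1 :+ l))) refl (2 ℕ.^ k) k l ⟩
  2 ℕ.^ suc k ℕ.* (suc k ℕ.* suc l) ∎
  where open ≡-Reasoning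

total-weight-positive : ∀ m k → 0 ℕ.< total (weight m) (suc k)
total-weight-positive m k = ℕ.≤-trans (ℕ.m^n>0 2 k)
  (ℕ.≤-trans (ℕ.m≤m*n (2 ℕ.^ k) _) (ℕ.m≤m+n (weight m k) _))

-- Holding item k against an optimum with all items up to k + 1: the weight of
-- item k exceeds a quarter of the optimum by 2 * 2 ^ k only.
deficit : ∀ k l → 4 ℕ.* weight (suc k ℕ.+ l) k
                  ≡ total (weight (suc k ℕ.+ l)) (2 ℕ.+ k) ℕ.+ 8 ℕ.* 2 ℕ.^ k
deficit k l = begin
  4 ℕ.* weight (suc k ℕ.+ l) k
    ≡⟨ cong (λ m → 4 ℕ.* weight m k) (ℕ.+-suc k l) ⟨
  4 ℕ.* weight (k ℕ.+ suc l) k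
    ≡⟨ cong (4 ℕ.*_) (weight-+ k (suc l)) ⟩
  4 ℕ.* (2 ℕ.^ k ℕ.* (2 ℕ.+ (2 ℕ.+ k) ℕ.* suc l))
    ≡⟨ solve 3 (λ p k l → con 4 :* (p :* (con 2 :+ (con 2 :+ k) :* (con 1 :+ l)))
                  := con 2 :* (con 2 :* p) :* ((con 2 :+ k) :* (con 1 :+ l)) :+ con 8 :* p)
         refl (2 ℕ.^ k) k l ⟩
  2 ℕ.^ (2 ℕ.+ k) ℕ.* ((2 ℕ.+ k) ℕ.* suc l) ℕ.+ 8 ℕ.* 2 ℕ.^ k
    ≡⟨ cong (ℕ._+ 8 ℕ.* 2 ℕ.^ k) (total-weight (suc k ℕ.+ l) (2 ℕ.+ k) l refl) ⟨
  total (weight (suc k ℕ.+ l)) (2 ℕ.+ k) ℕ.+ 8 ℕ.* 2 ℕ.^ k ∎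
  where open ≡-Reasoning

-- So the deficit is at most 8 / m times the weight.
weight-≥ : ∀ k l → (suc k ℕ.+ l) ℕ.* 2 ℕ.^ k ℕ.≤ weight (suc k ℕ.+ l) k
weight-≥ k l = begin
  (suc k ℕ.+ l) ℕ.* p
    ≤⟨ ℕ.m≤m+n _ _ ⟩
  (suc k ℕ.+ l) ℕ.* p ℕ.+ p ℕ.* (3 ℕ.+ l ℕ.+ k ℕ.* l)
    ≡⟨ solve 3 (λ p k l → (con 1 :+ k :+ l) :* p :+ p :* (con 3 :+ l :+ k :* l)
                  := p :* (con 2 :+ (con 2 :+ k) :* (con 1 :+ l))) refl p k l ⟩
  p ℕ.* (2 ℕ.+ (2 ℕ.+ k) ℕ.* suc l)
    ≡⟨ weight-+ k (suc l) ⟨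
  weight (k ℕ.+ suc l) k
    ≡⟨ cong (λ m → weight m k) (ℕ.+-suc k l) ⟩
  weight (suc k ℕ.+ l) k ∎
  where
  open ℕ.≤-Reasoning
  p = 2 ℕ.^ k

-- The last weight is 2 ^ (m + 1), and the total is m + 1 times as large.
last-weight : ∀ {m} → 3 ℕ.≤ m → 4 ℕ.* weight m m ℕ.≤ total (weight m) (suc m)
last-weight {m} 3≤m = begin
  4 ℕ.* weight m m
    ≡⟨ cong (λ d → 4 ℕ.* (p ℕ.* (2 ℕ.+ (2 ℕ.+ m) ℕ.* d))) (ℕ.n∸n≡0 m) ⟩
  4 ℕ.* (p ℕ.* (2 ℕ.+ (2 ℕ.+ m) ℕ.* 0))
    ≡⟨ solve 2 (λ p m → con 4 :* (p :* (con 2 :+ (con 2 :+ m) :* con 0))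
                  := con 2 :* p :* (con 4 :* con 1)) refl p m ⟩
  2 ℕ.* p ℕ.* (4 ℕ.* 1)
    ≤⟨ ℕ.*-monoʳ-≤ (2 ℕ.* p) (ℕ.*-monoˡ-≤ 1 (s≤s 3≤m)) ⟩
  2 ℕ.* p ℕ.* (suc m ℕ.* 1)
    ≡⟨ total-weight m (suc m) 0 (ℕ.+-identityʳ (suc m)) ⟨
  total (weight m) (suc m) ∎
  where
  open ℕ.≤-Reasoning
  p = 2 ℕ.^ m

-- The fatal comparisons, with slack ε

module _ {ε} (0<ε : 0ℚ ℚ.< ε) where
  open ℚ.≤-Reasoning

  0≤ε*fromℕ : ∀ n → 0ℚ ℚ.≤ ε ℚ.* fromℕ n
  0≤ε*fromℕ n = *-mono {0ℚ} {ε} {0ℚ} {fromℕ n} ℚ.≤-refl (0≤fromℕ n) (ℚ.<⇒≤ 0<ε) (0≤fromℕ n)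

  last-loss : ∀ {m} → 3 ℕ.≤ m →
    fromℕ 4 ℚ.* fromℕ (weight m m) ℚ.≤ fromℕ (total (weight m) (suc m)) ℚ.+ ε ℚ.* fromℕ (weight m m)
  last-loss {m} 3≤m = begin
    fromℕ 4 ℚ.* fromℕ (weight m m)        ≡⟨ fromℕ-* 4 (weight m m) ⟨
    fromℕ (4 ℕ.* weight m m)              ≤⟨ fromℕ-mono-≤ (last-weight 3≤m) ⟩
    fromℕ (total (weight m) (suc m))      ≡⟨ ℚ.+-identityʳ _ ⟨
    fromℕ (total (weight m) (suc m)) ℚ.+ 0ℚ
      ≤⟨ ℚ.+-monoʳ-≤ (fromℕ (total (weight m) (suc m))) (0≤ε*fromℕ (weight m m)) ⟩
    fromℕ (total (weight m) (suc m)) ℚ.+ ε ℚ.* fromℕ (weight m m) ∎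

  rejection-loss : ∀ {m} → fromℕ 8 ℚ.≤ fromℕ m ℚ.* ε → ∀ k → k ℕ.≤ m →
    fromℕ 4 ℚ.* fromℕ (held-weight (weight m) k)
      ℚ.≤ fromℕ (total (weight m) (suc k)) ℚ.+ ε ℚ.* fromℕ (held-weight (weight m) k)
  rejection-loss {m} 8≤mε zero _ = begin
    fromℕ 4 ℚ.* fromℕ 0                    ≡⟨ trans (cong (fromℕ 4 ℚ.*_) fromℕ-0) (ℚ.*-zeroʳ (fromℕ 4)) ⟩
    0ℚ                                     ≡⟨ ℚ.+-identityʳ 0ℚ ⟨
    0ℚ ℚ.+ 0ℚ                              ≤⟨ ℚ.+-mono-≤ (0≤fromℕ t) (0≤ε*fromℕ 0) ⟩
    fromℕ t ℚ.+ ε ℚ.* fromℕ 0              ∎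
    where t = total (weight m) 1
  rejection-loss {m} 8≤mε (suc k) k<m with ℕ.m≤n⇒∃[o]m+o≡n k<m
  ... | l , refl = begin
    fromℕ 4 ℚ.* fromℕ s                    ≡⟨ fromℕ-* 4 s ⟨
    fromℕ (4 ℕ.* s)                        ≡⟨ cong fromℕ (deficit k l) ⟩
    fromℕ (t ℕ.+ 8 ℕ.* p)                  ≡⟨ fromℕ-+ t (8 ℕ.* p) ⟩
    fromℕ t ℚ.+ fromℕ (8 ℕ.* p)            ≡⟨ cong (fromℕ t ℚ.+_) (fromℕ-* 8 p) ⟩
    fromℕ t ℚ.+ fromℕ 8 ℚ.* fromℕ p        ≤⟨ ℚ.+-monoʳ-≤ (fromℕ t) 8p≤εs ⟩
    fromℕ t ℚ.+ ε ℚ.* fromℕ s              ∎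
    where
    s = weight m k
    t = total (weight m) (2 ℕ.+ k)
    p = 2 ℕ.^ k

    8p≤εs : fromℕ 8 ℚ.* fromℕ p ℚ.≤ ε ℚ.* fromℕ s
    8p≤εs = begin
      fromℕ 8 ℚ.* fromℕ p         ≤⟨ ℚ.*-monoʳ-≤-nonNeg (fromℕ p) {{ℚ.nonNegative (0≤fromℕ p)}} 8≤mε ⟩
      fromℕ m ℚ.* ε ℚ.* fromℕ p   ≡⟨ cong (ℚ._* fromℕ p) (ℚ.*-comm (fromℕ m) ε) ⟩
      ε ℚ.* fromℕ m ℚ.* fromℕ p   ≡⟨ ℚ.*-assoc ε (fromℕ m) (fromℕ p) ⟩
      ε ℚ.* (fromℕ m ℚ.* fromℕ p) ≡⟨ cong (ε ℚ.*_) (fromℕ-* m p) ⟨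
      ε ℚ.* fromℕ (m ℕ.* p)       ≤⟨ ℚ.*-monoˡ-≤-nonNeg ε {{ℚ.nonNegative (ℚ.<⇒≤ 0<ε)}}
                                       (fromℕ-mono-≤ (weight-≥ k l)) ⟩
      ε ℚ.* fromℕ s               ∎

-- Here m must be at least 8 / ε for the rejections and at least 3 for the last
-- item.
strictly-monotone-not-competitive :
  ∀ α {0<α} r {ε N} → 0ℚ ℚ.< ε → (∀ n → N ℕ.≤ n → seq α n ℚ.+ ε ℚ.≤ fromℕ 4) →
  recip α 0<α < r → ∀ A → StrictlyMonotone A → ¬ HasCompetitiveRatio A r
strictly-monotone-not-competitive α {0<α} r {ε} {N} 0<ε α+ε≤4 α⁻¹<r A strict competitive =
  not-competitive (weight m) A strict r competitive m
    (λ k k≤m → hopeless (total-weight-positive m k) (rejection-loss 0<ε 8≤mε k k≤m))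
    (hopeless (total-weight-positive m m) (last-loss 0<ε (ℕ.m≤m+n 3 n)))
  where
  n = proj₁ (archimedean 8 ε 0<ε)
  m = 3 ℕ.+ n

  8≤mε : fromℕ 8 ℚ.≤ fromℕ m ℚ.* ε
  8≤mε = ℚ.≤-trans (proj₂ (archimedean 8 ε 0<ε))
    (ℚ.*-monoʳ-≤-nonNeg ε {{ℚ.nonNegative (ℚ.<⇒≤ 0<ε)}} (fromℕ-mono-≤ (ℕ.m≤n+m n 3)))

  hopeless : ∀ {s t} → 0 ℕ.< t → fromℕ 4 ℚ.* fromℕ s ℚ.≤ fromℕ t ℚ.+ ε ℚ.* fromℕ s →
             Loses r s t
  hopeless {s} {t} = loses α {0<α} r {ε} {N} α+ε≤4 α⁻¹<r s t

theorem6p1 : (α : ℝ) (0<α : 0ℝ < α) → α < fromℚ (+ 4 / 1) →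
    ¬ (∃[ A ] (StrictlyMonotone A × ∃[ r ] (recip α 0<α < r × HasCompetitiveRatio A r)))
theorem6p1 α 0<α (ε , 0<ε , N , α+ε≤4) (A , strict , r , α⁻¹<r , competitive) =
  strictly-monotone-not-competitive α {0<α} r {ε} {N} 0<ε
    (λ n N≤n → subst (seq α n ℚ.+ ε ℚ.≤_) (sym fromℕ-4) (α+ε≤4 n N≤n))
    α⁻¹<r A strict competitive
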